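{- Let $\mathcal{H}=\{rrb,bbr,yyr\}$. Then $h_2(n,\mathcal{H})=\lceil n/2\rceil$.
   Context: Here $n$ denotes the number of vertices of the complete graph $K_n$. Edge-colorings of $K_n$ use colors from $\{r,b,y\}$ (red, blue, yellow); they need not be proper, and not all colors need be used. A pattern is an edge-colored triangle, denoted by the multiset of the colors of its three edges; e.g. $rrb$ is the triangle with two red edges and one blue edge, $bbr$ has two blue edges and one red edge, $yyr$ has two yellow edges and one red edge. For a family $\mathcal{H}$ of patterns, $\operatorname{Forb}(n,\mathcal{H})$ is the set of all edge-colorings of $K_n$ with colors from $\{r,b,y\}$ in which no triangle has a coloring belonging to $\mathcal{H}$. For an edge-coloring $c$ of $K_n$, $h_2(c)$ is the maximum $k$ such that there is a set of $k$ vertices whose induced edges use at most two of the three colors. Finally, $h_2(n,\mathcal{H})=\min\{h_2(c): c\in\operatorname{Forb}(n,\mathcal{H})\}$.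
   Formalization: The case n = 2 is excluded, since there the single edge of K_2 makes h_2(2,H) = 2 while ⌈2/2⌉ = 1; all other n are covered. -}

module Defs where

open import Data.Nat using (ℕ; _≤_)
open import Data.Fin using (Fin)
open import Data.Fin.Subset using (Subset; _∈_; ∣_∣)
open import Data.List using (List)
open import Data.List.Relation.Unary.Any using (Any)
open import Data.List.Relation.Binary.Permutation.Propositional using (_↭_)
open import Data.Product using (_×_; ∃-syntax)
open import Data.Sum using (_⊎_)
open import Data.Vec using (Vec; []; _∷_; toList)
open import Relation.Binary.PropositionalEquality using (_≡_; _≢_)
open import Relation.Nullary using (¬_)

data Color : Set where
  red blue yellow : Color

-- An edge-coloring of the complete graph on the vertex set Fin n.  The edge
-- {i , j}, i ≢ j, has color  color i j.  The diagonal values are junk: every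
-- definition below looks only at pairs of distinct vertices.
record Coloring (n : ℕ) : Set where
  field
    color     : Fin n → Fin n → Color
    color-sym : ∀ i j → color i j ≡ color j i

open Coloring public

-- The multiset of the three edge colors of a triangle, listed in any order;
-- patterns are compared only up to permutation.
Pattern : Set
Pattern = Vec Color 3

_≈ᴾ_ : Pattern → Pattern → Set
P ≈ᴾ Q = toList P ↭ toList Q

rrb bbr yyr : Pattern
rrb = red    ∷ red    ∷ blue ∷ []
bbr = blue   ∷ blue   ∷ red  ∷ []
yyr = yellow ∷ yellow ∷ red  ∷ []

triangle : ∀ {n} → Coloring n → Fin n → Fin n → Fin n → Pattern
triangle c i j k = color c i j ∷ color c j k ∷ color c i k ∷ []

-- Membership of c in Forb(n , H).
Forb : (n : ℕ) → List Pattern → Coloring n → Set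
Forb n H c = ∀ i j k → i ≢ j → j ≢ k → i ≢ k →
             ¬ Any (λ P → triangle c i j k ≈ᴾ P) H

-- The two colors a and b are allowed to coincide.
AtMostTwoColors : ∀ {n} → Coloring n → Subset n → Set
AtMostTwoColors c S =
  ∃[ a ] ∃[ b ] (∀ i j → i ∈ S → j ∈ S → i ≢ j →
                 color c i j ≡ a ⊎ color c i j ≡ b)

IsMax IsMin : (ℕ → Set) → ℕ → Set
IsMax P m = P m × (∀ k → P k → k ≤ m)
IsMin P m = P m × (∀ k → P k → m ≤ k)

-- h₂ c ≔ k  says that h₂(c) = k.
h₂_≔_ : ∀ {n} → Coloring n → ℕ → Set
h₂ c ≔ k = IsMax (λ l → ∃[ S ] (∣ S ∣ ≡ l × AtMostTwoColors c S)) k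

-- h₂[ n , H ]≔ k  says that h₂(n , H) = k.
h₂[_,_]≔_ : (n : ℕ) → List Pattern → ℕ → Set
h₂[ n , H ]≔ k = IsMin (λ l → ∃[ c ] (Forb n H c × h₂ c ≔ l)) k

{-# OPTIONS --safe #-}
-- Lower bound.  Let uv be a red edge (without one, only blue and yellow
-- occur).  If uv lies in a red triangle, then every vertex is joined in red to
-- all but at most one vertex of that triangle, so any two vertices have a common
-- red neighbour in it, and no edge is blue.  Otherwise every vertex other than
-- u and v is joined in yellow to u or to v, and the closed yellow neighbourhoods
-- of u and v are free of red edges, so one of them has at least n/2 vertices.
--
-- Upper bound.  Pair up the vertices, one being left over if n is odd, and put
-- the two members of each pair on different sides.  Color an edge red inside a
-- pair, blue within a side, and yellow otherwise.  A set that contains a red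
-- edge and a third vertex sees all three colors; any other two-colored set is a
-- red edge or meets each pair at most once.
module Submission where

open import Defs
open import Data.Empty using (⊥; ⊥-elim)
open import Data.Fin using (Fin; zero; suc; _≟_)
open import Data.Fin.Properties using (any?; injective⇒≤; suc-injective)
open import Data.Fin.Subset using (Subset; inside; outside; _∈_; _∉_; ∣_∣; ∁) renaming (⊤ to full)
open import Data.Fin.Subset.Properties using (_∈?_; ∣⊤∣≡n; ∣p∣≤n; ∣∁p∣≡n∸∣p∣; p⊆q⇒∣p∣≤∣q∣; x∈∁p⇒x∉p)
open import Data.List using (List; []; _∷_)
open import Data.List.Relation.Binary.Permutation.Propositional using (_↭_; ↭-refl; ↭-sym)
open import Data.List.Relation.Binary.Permutation.Propositional.Properties using (∈-resp-↭; All-resp-↭; drop-mid)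
open import Data.List.Relation.Unary.All using ([]; _∷_)
open import Data.List.Relation.Unary.Any using (Any; here; there)
open import Data.Nat using (ℕ; zero; suc; _+_; _≤_; z≤n; s≤s; ⌈_/2⌉)
open import Data.Nat.Properties using (≤-trans; ≤-reflexive; +-mono-≤; +-monoʳ-≤; m≤m+n; m+[n∸m]≡n; ⌈n/2⌉-mono; n≡⌈n+n/2⌉)
open import Data.Product using (_×_; _,_; proj₁; proj₂; ∃-syntax)
open import Data.Sum using (_⊎_; inj₁; inj₂; [_,_]′)
open import Data.Vec using ([]; _∷_; here; there; tabulate)
open import Data.Vec.Properties using (lookup∘tabulate; lookup⇒[]=; []=⇒lookup)
open import Function using (_∘_)
open import Relation.Binary.Definitions using (DecidableEquality)
open import Relation.Binary.PropositionalEquality using (_≡_; _≢_; refl; sym; trans; cong; subst; ≢-sym)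
open import Relation.Nullary using (¬_; Dec; yes; no; does; contradiction)
open import Relation.Nullary.Decidable using (_×-dec_; _⊎-dec_; ¬?; dec-true)
open import Relation.Unary using (Decidable)

-- The three colors

_≟ᶜ_ : DecidableEquality Color
red    ≟ᶜ red    = yes refl
red    ≟ᶜ blue   = no λ ()
red    ≟ᶜ yellow = no λ ()
blue   ≟ᶜ red    = no λ ()
blue   ≟ᶜ blue   = yes refl
blue   ≟ᶜ yellow = no λ ()
yellow ≟ᶜ red    = no λ ()
yellow ≟ᶜ blue   = no λ ()
yellow ≟ᶜ yellow = yes refl

≢red⇒blue⊎yellow : ∀ x → x ≢ red → x ≡ blue ⊎ x ≡ yellow
≢red⇒blue⊎yellow red    x≢r = contradiction refl x≢r
≢red⇒blue⊎yellow blue   _   = inj₁ refl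
≢red⇒blue⊎yellow yellow _   = inj₂ refl

≢blue⇒red⊎yellow : ∀ x → x ≢ blue → x ≡ red ⊎ x ≡ yellow
≢blue⇒red⊎yellow red    _   = inj₁ refl
≢blue⇒red⊎yellow blue   x≢b = contradiction refl x≢b
≢blue⇒red⊎yellow yellow _   = inj₂ refl

not-all-colors : ∀ {a b : Color} → ¬ (∀ x → x ≡ a ⊎ x ≡ b)
not-all-colors f with f red | f blue | f yellow
... | inj₁ refl | inj₁ () | _
... | inj₁ refl | inj₂ refl | inj₁ ()
... | inj₁ refl | inj₂ refl | inj₂ ()
... | inj₂ refl | inj₂ () | _
... | inj₂ refl | inj₁ refl | inj₁ ()
... | inj₂ refl | inj₁ refl | inj₂ ()

-- At most one of the three can fail. This is applied to red adjacency to the three vertices of a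
-- red triangle.
two-of-three : ∀ {A B C : Set} → A ⊎ B → A ⊎ C → B ⊎ C → (A × B) ⊎ (A × C) ⊎ (B × C)
two-of-three (inj₁ a) _        (inj₁ b) = inj₁ (a , b)
two-of-three (inj₁ a) _        (inj₂ c) = inj₂ (inj₁ (a , c))
two-of-three (inj₂ b) (inj₁ a) _        = inj₁ (a , b)
two-of-three (inj₂ b) (inj₂ c) _        = inj₂ (inj₂ (b , c))

-- Finite subsets and their sizes

⟨_⟩ : ∀ {n} {P : Fin n → Set} → Decidable P → Subset n
⟨ P? ⟩ = tabulate (does ∘ P?)

∈⟨⟩⁺ : ∀ {n} {P : Fin n → Set} (P? : Decidable P) {i} → P i → i ∈ ⟨ P? ⟩
∈⟨⟩⁺ P? {i} p =
  lookup⇒[]= i ⟨ P? ⟩ (trans (lookup∘tabulate (does ∘ P?) i) (dec-true (P? i) p))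

∈⟨⟩⁻ : ∀ {n} {P : Fin n → Set} (P? : Decidable P) {i} → i ∈ ⟨ P? ⟩ → P i
∈⟨⟩⁻ P? {i} i∈ with P? i | trans (sym (lookup∘tabulate (does ∘ P?) i)) ([]=⇒lookup i∈)
... | yes p | _ = p
... | no _  | ()

cover⇒n≤∣p∣+∣q∣ : ∀ {n} (p q : Subset n) → (∀ {i} → i ∉ p → i ∈ q) → n ≤ ∣ p ∣ + ∣ q ∣
cover⇒n≤∣p∣+∣q∣ p q cover =
  ≤-trans (≤-reflexive (sym (trans (cong (∣ p ∣ +_) (∣∁p∣≡n∸∣p∣ p)) (m+[n∸m]≡n (∣p∣≤n p)))))
          (+-monoʳ-≤ ∣ p ∣ (p⊆q⇒∣p∣≤∣q∣ (cover ∘ x∈∁p⇒x∉p)))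

-- The increasing enumeration of `S`; it reduces bounds on `∣ S ∣` to the pigeonhole principle for
-- `Fin`.
enum : ∀ {n} (S : Subset n) → Fin ∣ S ∣ → Fin n
enum (inside  ∷ S) zero    = zero
enum (inside  ∷ S) (suc k) = suc (enum S k)
enum (outside ∷ S) k       = suc (enum S k)

enum-∈ : ∀ {n} (S : Subset n) k → enum S k ∈ S
enum-∈ (inside  ∷ S) zero    = here
enum-∈ (inside  ∷ S) (suc k) = there (enum-∈ S k)
enum-∈ (outside ∷ S) k       = there (enum-∈ S k)

enum-injective : ∀ {n} (S : Subset n) {k l} → enum S k ≡ enum S l → k ≡ l
enum-injective (inside  ∷ S) {zero}  {zero}  _  = refl
enum-injective (inside  ∷ S) {suc k} {suc l} eq = cong suc (enum-injective S (suc-injective eq))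
enum-injective (outside ∷ S)                 eq = enum-injective S (suc-injective eq)

injectiveOn⇒∣S∣≤m : ∀ {m n} (S : Subset n) (f : Fin n → Fin m) →
                    (∀ {i j} → i ∈ S → j ∈ S → f i ≡ f j → i ≡ j) → ∣ S ∣ ≤ m
injectiveOn⇒∣S∣≤m S f inj =
  injective⇒≤ {f = f ∘ enum S} (enum-injective S ∘ inj (enum-∈ S _) (enum-∈ S _))

H : List Pattern
H = rrb ∷ bbr ∷ yyr ∷ []

HasTwoColoredSet : ∀ {n} → Coloring n → ℕ → Set
HasTwoColoredSet c l = ∃[ S ] (∣ S ∣ ≡ l × AtMostTwoColors c S)

-- The lower bound

module _ {n : ℕ} (c : Coloring n) (forb : Forb n H c) where

  flip-edge : ∀ {i j p} → color c i j ≡ p → color c j i ≡ p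
  flip-edge {i} {j} = trans (color-sym c j i)

  -- The colors enter through equations, so that each use only names a pattern of literal colors,
  -- matched by `↭-refl`. The third color listed belongs to the edge `i k`.
  avoids : ∀ {i j k p q s} → Any (λ P → (p ∷ q ∷ s ∷ []) ≈ᴾ P) H →
           i ≢ j → j ≢ k → i ≢ k →
           color c i j ≡ p → color c j k ≡ q → color c i k ≡ s → ⊥
  avoids P∈H i≢j j≢k i≢k refl refl refl = forb _ _ _ i≢j j≢k i≢k P∈H

  no-rrb : ∀ {i j k} → i ≢ j → j ≢ k → i ≢ k →
           color c i j ≡ red → color c j k ≡ red → color c i k ≡ blue → ⊥
  no-rrb = avoids (here ↭-refl)

  no-bbr : ∀ {i j k} → i ≢ j → j ≢ k → i ≢ k →
           color c i j ≡ blue → color c j k ≡ blue → color c i k ≡ red → ⊥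
  no-bbr = avoids (there (here ↭-refl))

  no-yyr : ∀ {i j k} → i ≢ j → j ≢ k → i ≢ k →
           color c i j ≡ yellow → color c j k ≡ yellow → color c i k ≡ red → ⊥
  no-yyr = avoids (there (there (here ↭-refl)))

  no-red⇒two-colored : (∀ {i j} → i ≢ j → color c i j ≢ red) → AtMostTwoColors c full
  no-red⇒two-colored no-red =
    blue , yellow , λ i j _ _ i≢j → ≢red⇒blue⊎yellow _ (no-red i≢j)

  -- Red triangles

  _≡⊎red_ : Fin n → Fin n → Set
  x ≡⊎red u = x ≡ u ⊎ color c x u ≡ red

  record RedTriangle (u v w : Fin n) : Set where
    constructor redTriangle
    field
      u≢v : u ≢ v
      u≢w : u ≢ w
      v≢w : v ≢ w
      uv  : color c u v ≡ red
      uw  : color c u w ≡ red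
      vw  : color c v w ≡ red

  rotate : ∀ {u v w} → RedTriangle u v w → RedTriangle v w u
  rotate (redTriangle u≢v u≢w v≢w uv uw vw) =
    redTriangle v≢w (≢-sym u≢v) (≢-sym u≢w) vw (flip-edge uv) (flip-edge uw)

  -- Suppose that neither `x u` nor `x v` is red. Equal colors on them would form `bbr` or `yyr`
  -- with the red `u v`, so one is blue and the other yellow. Then a red `x w` gives `rrb` with the
  -- blue edge, and a blue or yellow one gives `bbr` or `yyr` with the edge of its own color.
  red-to-two : ∀ {u v w} → RedTriangle u v w → ∀ x → x ≡⊎red u ⊎ x ≡⊎red v
  red-to-two {u} {v} {w} (redTriangle u≢v u≢w v≢w uv uw vw) x
    with x ≟ u | x ≟ v | x ≟ w
  ... | yes x≡u | _       | _        = inj₁ (inj₁ x≡u)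
  ... | no _    | yes x≡v | _        = inj₂ (inj₁ x≡v)
  ... | no _    | no _    | yes refl = inj₁ (inj₂ (flip-edge uw))
  ... | no x≢u  | no x≢v  | no x≢w
    with color c x u in xu | color c x v in xv | color c x w in xw
  ... | red    | _      | _      = inj₁ (inj₂ refl)
  ... | blue   | red    | _      = inj₂ (inj₂ refl)
  ... | yellow | red    | _      = inj₂ (inj₂ refl)
  ... | blue   | blue   | _      = ⊥-elim (no-bbr (≢-sym x≢u) x≢v u≢v (flip-edge xu) xv uv)
  ... | yellow | yellow | _      = ⊥-elim (no-yyr (≢-sym x≢u) x≢v u≢v (flip-edge xu) xv uv)
  ... | blue   | yellow | red    = ⊥-elim (no-rrb x≢w (≢-sym u≢w) x≢u xw (flip-edge uw) xu)
  ... | blue   | yellow | blue   = ⊥-elim (no-bbr (≢-sym x≢u) x≢w u≢w (flip-edge xu) xw uw)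
  ... | blue   | yellow | yellow = ⊥-elim (no-yyr (≢-sym x≢v) x≢w v≢w (flip-edge xv) xw vw)
  ... | yellow | blue   | red    = ⊥-elim (no-rrb x≢w (≢-sym v≢w) x≢v xw (flip-edge vw) xv)
  ... | yellow | blue   | blue   = ⊥-elim (no-bbr (≢-sym x≢v) x≢w v≢w (flip-edge xv) xw vw)
  ... | yellow | blue   | yellow = ⊥-elim (no-yyr (≢-sym x≢u) x≢w u≢w (flip-edge xu) xw uw)

  common-red⇒≢blue : ∀ {x y k} → x ≢ y → x ≡⊎red k → y ≡⊎red k → color c x y ≢ blue
  -- The equalities are decided first because a red `color c x k` does not rule out `x ≡ k`: it may
  -- be a diagonal value.
  common-red⇒≢blue {x} {y} {k} x≢y x~k y~k xy with x ≟ k | y ≟ k | x~k | y~k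
  ... | yes refl | yes refl | _        | _        = x≢y refl
  ... | yes refl | no y≢k   | _        | inj₁ y≡k = y≢k y≡k
  ... | yes refl | no _     | _        | inj₂ yx  = contradiction (trans (sym (flip-edge yx)) xy) λ ()
  ... | no x≢k   | _        | inj₁ x≡k | _        = x≢k x≡k
  ... | no _     | yes refl | inj₂ xy′ | _        = contradiction (trans (sym xy′) xy) λ ()
  ... | no _     | no y≢k   | inj₂ _   | inj₁ y≡k = y≢k y≡k
  ... | no x≢k   | no y≢k   | inj₂ xk  | inj₂ yk  = no-rrb x≢k (≢-sym y≢k) x≢y xk (flip-edge yk) xy

  -- Two of the triangle's vertices are equal or red-joined to `x`, and at least one of those two is
  -- so to `y`.
  red-triangle⇒no-blue : ∀ {u v w} → RedTriangle u v w → ∀ {x y} → x ≢ y → color c x y ≢ blue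
  red-triangle⇒no-blue {u} {v} {w} t {x} {y} x≢y
    -- Rotating twice yields the pair `w`, `u`; the swap restores the order that `two-of-three`
    -- expects.
    with two-of-three (red-to-two t x) ([ inj₂ , inj₁ ]′ (red-to-two (rotate (rotate t)) x))
                      (red-to-two (rotate t) x)
  ... | inj₁ (xu , xv)        = [ common-red⇒≢blue x≢y xu , common-red⇒≢blue x≢y xv ]′ (red-to-two t y)
  ... | inj₂ (inj₁ (xu , xw)) = [ common-red⇒≢blue x≢y xw , common-red⇒≢blue x≢y xu ]′ (red-to-two (rotate (rotate t)) y)
  ... | inj₂ (inj₂ (xv , xw)) = [ common-red⇒≢blue x≢y xv , common-red⇒≢blue x≢y xw ]′ (red-to-two (rotate t) y)

  red-triangle⇒two-colored : ∀ {u v w} → RedTriangle u v w → AtMostTwoColors c full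
  red-triangle⇒two-colored t =
    red , yellow , λ i j _ _ i≢j → ≢blue⇒red⊎yellow _ (red-triangle⇒no-blue t i≢j)

  -- Closed yellow neighbourhoods

  yellow-closed? : ∀ u → Decidable (λ x → u ≡ x ⊎ color c u x ≡ yellow)
  yellow-closed? u x = (u ≟ x) ⊎-dec (color c u x ≟ᶜ yellow)

  N[_] : Fin n → Subset n
  N[ u ] = ⟨ yellow-closed? u ⟩

  -- A red edge between two yellow neighbours of `u` would complete `yyr`; the edges at `u` are
  -- yellow.
  N-two-colored : ∀ u → AtMostTwoColors c N[ u ]
  N-two-colored u = blue , yellow , go
    where
    go : ∀ i j → i ∈ N[ u ] → j ∈ N[ u ] → i ≢ j → color c i j ≡ blue ⊎ color c i j ≡ yellow
    go i j i∈ j∈ i≢j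
      with u ≟ i | u ≟ j | ∈⟨⟩⁻ (yellow-closed? u) i∈ | ∈⟨⟩⁻ (yellow-closed? u) j∈
    ... | yes refl | _        | _       | inj₁ u≡j = contradiction u≡j i≢j
    ... | yes refl | _        | _       | inj₂ uj  = inj₂ uj
    ... | no u≢i   | _        | inj₁ u≡i | _       = contradiction u≡i u≢i
    ... | no _     | yes refl | inj₂ ui | _        = inj₂ (flip-edge ui)
    ... | no _     | no u≢j   | inj₂ _  | inj₁ u≡j = contradiction u≡j u≢j
    ... | no u≢i   | no u≢j   | inj₂ ui | inj₂ uj  =
      ≢red⇒blue⊎yellow _ (no-yyr (≢-sym u≢i) u≢j i≢j (flip-edge ui) uj)

  -- Here `u x` is red or blue. If `v x` were also red or blue, then together with the red `u v`
  -- they would form a red triangle, `rrb` or `bbr`.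
  N-cover : ∀ {u v} → u ≢ v → color c u v ≡ red → (∀ {w} → ¬ RedTriangle u v w) →
            ∀ {x} → x ∉ N[ u ] → x ∈ N[ v ]
  N-cover {u} {v} u≢v uv no-triangle {x} x∉Nu = ∈⟨⟩⁺ (yellow-closed? v) x~v
    where
    u≢x : u ≢ x
    u≢x = x∉Nu ∘ ∈⟨⟩⁺ (yellow-closed? u) ∘ inj₁

    x~v : v ≡ x ⊎ color c v x ≡ yellow
    x~v with v ≟ x
    ... | yes v≡x = inj₁ v≡x
    ... | no v≢x with color c u x in ux | color c v x in vx
    ...   | yellow | _      = contradiction (∈⟨⟩⁺ (yellow-closed? u) (inj₂ ux)) x∉Nu
    ...   | red    | red    = contradiction (redTriangle u≢v u≢x v≢x uv ux vx) no-triangle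
    ...   | red    | blue   = ⊥-elim (no-rrb (≢-sym u≢v) u≢x v≢x (flip-edge uv) ux vx)
    ...   | red    | yellow = inj₂ refl
    ...   | blue   | red    = ⊥-elim (no-rrb u≢v v≢x u≢x uv vx ux)
    ...   | blue   | blue   = ⊥-elim (no-bbr u≢x (≢-sym v≢x) u≢v ux (flip-edge vx) uv)
    ...   | blue   | yellow = inj₂ refl

  -- The bound on a largest two-colored set

  module _ {k : ℕ} (k-max : ∀ l → HasTwoColoredSet c l → l ≤ k) where

    ∣S∣≤k : ∀ S → AtMostTwoColors c S → ∣ S ∣ ≤ k
    ∣S∣≤k S two = k-max ∣ S ∣ (S , refl , two)

    full⇒n≤k+k : AtMostTwoColors c full → n ≤ k + k
    full⇒n≤k+k two = ≤-trans (subst (_≤ k) (∣⊤∣≡n n) (∣S∣≤k full two)) (m≤m+n k k)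

    redTriangle? : ∀ {u v} → u ≢ v → color c u v ≡ red → Decidable (RedTriangle u v)
    redTriangle? {u} {v} u≢v uv w
      with ¬? (u ≟ w) ×-dec ¬? (v ≟ w) ×-dec (color c u w ≟ᶜ red) ×-dec (color c v w ≟ᶜ red)
    ... | yes (u≢w , v≢w , uw , vw) = yes (redTriangle u≢v u≢w v≢w uv uw vw)
    ... | no ¬t = no λ { (redTriangle _ u≢w v≢w _ uw vw) → ¬t (u≢w , v≢w , uw , vw) }

    -- Doubling `k` avoids choosing the larger of the two neighbourhoods: each has at most `k`
    -- vertices and they cover everything.
    n≤k+k : n ≤ k + k
    n≤k+k with any? (λ u → any? (λ v → ¬? (u ≟ v) ×-dec (color c u v ≟ᶜ red)))
    ... | no ¬red = full⇒n≤k+k (no-red⇒two-colored λ i≢j ij → ¬red (_ , _ , i≢j , ij))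
    ... | yes (u , v , u≢v , uv) with any? (redTriangle? u≢v uv)
    ...   | yes (_ , t) = full⇒n≤k+k (red-triangle⇒two-colored t)
    ...   | no ¬t =
      ≤-trans (cover⇒n≤∣p∣+∣q∣ N[ u ] N[ v ] (N-cover u≢v uv λ t → ¬t (_ , t)))
              (+-mono-≤ (∣S∣≤k N[ u ] (N-two-colored u)) (∣S∣≤k N[ v ] (N-two-colored v)))

    ⌈n/2⌉≤k : ⌈ n /2⌉ ≤ k
    ⌈n/2⌉≤k = subst (⌈ n /2⌉ ≤_) (sym (n≡⌈n+n/2⌉ k)) (⌈n/2⌉-mono n≤k+k)

-- The extremal coloring

-- The quotient of the index by 2, with `side` the remainder; for odd `n` the last vertex is alone
-- in its pair.
pair : ∀ {n} → Fin n → Fin ⌈ n /2⌉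
pair {suc zero}    zero          = zero
pair {suc (suc n)} zero          = zero
pair {suc (suc n)} (suc zero)    = zero
pair {suc (suc n)} (suc (suc i)) = suc (pair i)

side : ∀ {n} → Fin n → Fin 2
side zero          = zero
side (suc zero)    = suc zero
side (suc (suc i)) = side i

pair-side-injective : ∀ {n} {i j : Fin n} → pair i ≡ pair j → side i ≡ side j → i ≡ j
pair-side-injective {suc zero}    {zero}        {zero}        _ _ = refl
pair-side-injective {suc (suc n)} {zero}        {zero}        _ _ = refl
pair-side-injective {suc (suc n)} {suc zero}    {suc zero}    _ _ = refl
pair-side-injective {suc (suc n)} {zero}        {suc zero}    _ ()
pair-side-injective {suc (suc n)} {suc zero}    {zero}        _ ()
pair-side-injective {suc (suc n)} {zero}        {suc (suc j)} () _
pair-side-injective {suc (suc n)} {suc zero}    {suc (suc j)} () _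
pair-side-injective {suc (suc n)} {suc (suc i)} {suc (suc j)} p s =
  cong (λ k → suc (suc k)) (pair-side-injective (suc-injective p) s)

≢-≢⇒≡ : {x y z : Fin 2} → x ≢ y → y ≢ z → x ≡ z
≢-≢⇒≡ {zero}     {zero}     {_}        x≢y _   = contradiction refl x≢y
≢-≢⇒≡ {zero}     {suc zero} {zero}     _   _   = refl
≢-≢⇒≡ {zero}     {suc zero} {suc zero} _   y≢z = contradiction refl y≢z
≢-≢⇒≡ {suc zero} {suc zero} {_}        x≢y _   = contradiction refl x≢y
≢-≢⇒≡ {suc zero} {zero}     {suc zero} _   _   = refl
≢-≢⇒≡ {suc zero} {zero}     {zero}     _   y≢z = contradiction refl y≢z

-- Abstracting from the vertices lets the lemmas on colors go by cases on the two decisions. The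
-- pair is tested first, so that an edge inside a pair is red although its ends lie on different
-- sides.
hue : {P Q : Set} → Dec P → Dec Q → Color
hue (yes _) _       = red
hue (no _)  (yes _) = blue
hue (no _)  (no _)  = yellow

module _ {P Q : Set} where

  -- Needed for symmetry: exchanging the ends of an edge gives decisions of different, though
  -- equivalent, propositions.
  hue-cong : ∀ {P′ Q′ : Set} (P? : Dec P) (Q? : Dec Q) (P′? : Dec P′) (Q′? : Dec Q′) →
             (P → P′) → (P′ → P) → (Q → Q′) → (Q′ → Q) → hue P? Q? ≡ hue P′? Q′?
  hue-cong (yes _) _       (yes _)  _        _ _ _ _ = refl
  hue-cong (yes p) _       (no ¬p′) _        f _ _ _ = contradiction (f p) ¬p′
  hue-cong (no ¬p) _       (yes p′) _        _ f _ _ = contradiction (f p′) ¬p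
  hue-cong (no _)  (yes _) (no _)   (yes _)  _ _ _ _ = refl
  hue-cong (no _)  (yes q) (no _)   (no ¬q′) _ _ f _ = contradiction (f q) ¬q′
  hue-cong (no _)  (no ¬q) (no _)   (yes q′) _ _ _ f = contradiction (f q′) ¬q
  hue-cong (no _)  (no _)  (no _)   (no _)   _ _ _ _ = refl

  hue-red⁻ : (P? : Dec P) (Q? : Dec Q) → hue P? Q? ≡ red → P
  hue-red⁻ (yes p) _       _  = p
  hue-red⁻ (no _)  (yes _) ()
  hue-red⁻ (no _)  (no _)  ()

  hue-red⁺ : (P? : Dec P) (Q? : Dec Q) → P → hue P? Q? ≡ red
  hue-red⁺ (yes _) _ _ = refl
  hue-red⁺ (no ¬p) _ p = contradiction p ¬p

  hue-blue⁻ : (P? : Dec P) (Q? : Dec Q) → hue P? Q? ≡ blue → ¬ P × Q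
  hue-blue⁻ (no ¬p) (yes q) _ = ¬p , q

  hue-blue⁺ : (P? : Dec P) (Q? : Dec Q) → ¬ P → Q → hue P? Q? ≡ blue
  hue-blue⁺ (yes p) _       ¬p _ = contradiction p ¬p
  hue-blue⁺ (no _)  (yes _) _  _ = refl
  hue-blue⁺ (no _)  (no ¬q) _  q = contradiction q ¬q

  hue-yellow⁻ : (P? : Dec P) (Q? : Dec Q) → hue P? Q? ≡ yellow → ¬ Q
  hue-yellow⁻ (no _) (no ¬q) _ = ¬q

  hue-yellow⁺ : (P? : Dec P) (Q? : Dec Q) → ¬ P → ¬ Q → hue P? Q? ≡ yellow
  hue-yellow⁺ (yes p) _       ¬p _  = contradiction p ¬p
  hue-yellow⁺ (no _)  (yes q) _  ¬q = contradiction q ¬q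
  hue-yellow⁺ (no _)  (no _)  _  _  = refl

pairing : ∀ n → Coloring n
pairing n .color i j = hue (pair i ≟ pair j) (side i ≟ side j)
pairing n .color-sym i j =
  hue-cong (pair i ≟ pair j) (side i ≟ side j) (pair j ≟ pair i) (side j ≟ side i) sym sym sym sym

-- Locate `s` among the three entries and delete it; the other two are a permutation of
-- `p ∷ p ∷ []`, hence both equal `p`.
↭pps : ∀ {x y z p s : Color} → x ∷ y ∷ z ∷ [] ↭ p ∷ p ∷ s ∷ [] →
       (x ≡ p × y ≡ p × z ≡ s) ⊎ (x ≡ p × y ≡ s × z ≡ p) ⊎ (x ≡ s × y ≡ p × z ≡ p)
↭pps {x} {y} {z} {p} {s} σ with ∈-resp-↭ (↭-sym σ) (there (there (here refl)))
... | here refl with All-resp-↭ (↭-sym (drop-mid [] (p ∷ p ∷ []) σ)) (refl ∷ refl ∷ [])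
...   | y≡p ∷ z≡p ∷ [] = inj₂ (inj₂ (refl , y≡p , z≡p))
↭pps {x} {y} {z} {p} {s} σ | there (here refl)
    with All-resp-↭ (↭-sym (drop-mid (x ∷ []) (p ∷ p ∷ []) σ)) (refl ∷ refl ∷ [])
...   | x≡p ∷ z≡p ∷ [] = inj₂ (inj₁ (x≡p , refl , z≡p))
↭pps {x} {y} {z} {p} {s} σ | there (there (here refl))
    with All-resp-↭ (↭-sym (drop-mid (x ∷ y ∷ []) (p ∷ p ∷ []) σ)) (refl ∷ refl ∷ [])
...   | x≡p ∷ y≡p ∷ [] = inj₁ (x≡p , y≡p , refl)

-- By symmetry it suffices to exclude the triangles whose odd color is on the
-- third listed edge.
avoids-pps : ∀ {n} (c : Coloring n) {p s} →
             (∀ {i j k} → i ≢ k → color c i j ≡ p → color c j k ≡ p → color c i k ≢ s) →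
             ∀ {i j k} → i ≢ j → j ≢ k → i ≢ k → ¬ (triangle c i j k ≈ᴾ (p ∷ p ∷ s ∷ []))
avoids-pps c no-pps {i} {j} {k} i≢j j≢k i≢k σ with ↭pps σ
... | inj₁ (ij , jk , ik)        = no-pps i≢k ij jk ik
... | inj₂ (inj₁ (ij , jk , ik)) = no-pps j≢k (trans (color-sym c j i) ij) ik jk
... | inj₂ (inj₂ (ij , jk , ik)) = no-pps i≢j ik (trans (color-sym c k j) jk) ij

-- This is where `n ≢ 2` enters: for two vertices the single red edge is a two-colored set of size
-- 2, while `⌈ 2 /2⌉` is 1.
2≤⌈n/2⌉ : ∀ {m} {i j : Fin m} → m ≢ 2 → i ≢ j → 2 ≤ ⌈ m /2⌉
2≤⌈n/2⌉ {suc zero} {zero} {zero} _ i≢j = contradiction refl i≢j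
2≤⌈n/2⌉ {suc (suc zero)} m≢2 _ = contradiction refl m≢2
2≤⌈n/2⌉ {suc (suc (suc m))} _ _ = s≤s (s≤s z≤n)

-- Forbidden patterns and two-colored sets in the pairing coloring

module _ {n : ℕ} where

  pairing-red⁻ : ∀ {i j} → color (pairing n) i j ≡ red → pair i ≡ pair j
  pairing-red⁻ {i} {j} = hue-red⁻ (pair i ≟ pair j) (side i ≟ side j)

  pairing-blue⁻ : ∀ {i j} → color (pairing n) i j ≡ blue → pair i ≢ pair j × side i ≡ side j
  pairing-blue⁻ {i} {j} = hue-blue⁻ (pair i ≟ pair j) (side i ≟ side j)

  pairing-yellow⁻ : ∀ {i j} → color (pairing n) i j ≡ yellow → side i ≢ side j
  pairing-yellow⁻ {i} {j} = hue-yellow⁻ (pair i ≟ pair j) (side i ≟ side j)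

  pairing-red⁺ : ∀ {i j} → pair i ≡ pair j → color (pairing n) i j ≡ red
  pairing-red⁺ {i} {j} = hue-red⁺ (pair i ≟ pair j) (side i ≟ side j)

  pairing-blue⁺ : ∀ {i j} → pair i ≢ pair j → side i ≡ side j → color (pairing n) i j ≡ blue
  pairing-blue⁺ {i} {j} = hue-blue⁺ (pair i ≟ pair j) (side i ≟ side j)

  pairing-yellow⁺ : ∀ {i j} → pair i ≢ pair j → side i ≢ side j → color (pairing n) i j ≡ yellow
  pairing-yellow⁺ {i} {j} = hue-yellow⁺ (pair i ≟ pair j) (side i ≟ side j)

  -- Two adjacent red edges stay within one pair, so the third edge is not blue. Two adjacent blue
  -- or two adjacent yellow edges lead back to the same side, whereas a red edge joins different
  -- sides.
  pairing-forb : Forb n H (pairing n)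
  pairing-forb i j k i≢j j≢k i≢k (here σ) =
    avoids-pps (pairing n)
      (λ _ ij jk ik → proj₁ (pairing-blue⁻ ik) (trans (pairing-red⁻ ij) (pairing-red⁻ jk)))
      i≢j j≢k i≢k σ
  pairing-forb i j k i≢j j≢k i≢k (there (here σ)) =
    avoids-pps (pairing n)
      (λ i≢k ij jk ik → i≢k (pair-side-injective (pairing-red⁻ ik)
        (trans (proj₂ (pairing-blue⁻ ij)) (proj₂ (pairing-blue⁻ jk)))))
      i≢j j≢k i≢k σ
  pairing-forb i j k i≢j j≢k i≢k (there (there (here σ))) =
    avoids-pps (pairing n)
      (λ i≢k ij jk ik → i≢k (pair-side-injective (pairing-red⁻ ik)
        (≢-≢⇒≡ (pairing-yellow⁻ ij) (pairing-yellow⁻ jk))))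
      i≢j j≢k i≢k σ

  module _ {S : Subset n} (two : AtMostTwoColors (pairing n) S)
           {i j : Fin n} (i∈S : i ∈ S) (j∈S : j ∈ S) (i≢j : i ≢ j) (pi≡pj : pair i ≡ pair j) where

    private
      Used : Color → Set
      Used x = x ≡ proj₁ two ⊎ x ≡ proj₁ (proj₂ two)

      used : ∀ {k l x} → k ∈ S → l ∈ S → k ≢ l → color (pairing n) k l ≡ x → Used x
      used k∈S l∈S k≢l refl = proj₂ (proj₂ two) _ _ k∈S l∈S k≢l

      ¬all-used : Used red → Used blue → Used yellow → ⊥
      ¬all-used r b y = not-all-colors λ { red → r ; blue → b ; yellow → y }

      si≢sj : side i ≢ side j
      si≢sj = i≢j ∘ pair-side-injective pi≡pj

      red-used : Used red
      red-used = used i∈S j∈S i≢j (pairing-red⁺ pi≡pj)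

    -- Since `i` and `j` lie on different sides, a vertex `k` of another pair shares its side with
    -- exactly one of them. Its edges to them are then one blue and one yellow, and with the red
    -- `i j` all three colors occur.
    same-pair : ∀ {k} → k ∈ S → pair k ≡ pair i
    same-pair {k} k∈S with pair k ≟ pair i
    ... | yes pk≡pi = pk≡pi
    ... | no pk≢pi  = ⊥-elim (blue-and-yellow (side k ≟ side i))
      where
      pk≢pj : pair k ≢ pair j
      pk≢pj pk≡pj = pk≢pi (trans pk≡pj (sym pi≡pj))

      k-i : ∀ {x} → color (pairing n) k i ≡ x → Used x
      k-i = used k∈S i∈S (pk≢pi ∘ cong pair)

      k-j : ∀ {x} → color (pairing n) k j ≡ x → Used x
      k-j = used k∈S j∈S (pk≢pj ∘ cong pair)

      blue-and-yellow : Dec (side k ≡ side i) → ⊥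
      blue-and-yellow (yes sk≡si) =
        ¬all-used red-used (k-i (pairing-blue⁺ pk≢pi sk≡si))
                           (k-j (pairing-yellow⁺ pk≢pj (si≢sj ∘ trans (sym sk≡si))))
      blue-and-yellow (no sk≢si) =
        ¬all-used red-used (k-j (pairing-blue⁺ pk≢pj (≢-≢⇒≡ sk≢si si≢sj)))
                           (k-i (pairing-yellow⁺ pk≢pi sk≢si))

    -- All of `S` lies in one pair, where `side` is injective.
    red-edge⇒∣S∣≤2 : ∣ S ∣ ≤ 2
    red-edge⇒∣S∣≤2 =
      injectiveOn⇒∣S∣≤m S side λ k∈S l∈S →
        pair-side-injective (trans (same-pair k∈S) (sym (same-pair l∈S)))

  two-colored⇒∣S∣≤⌈n/2⌉ : n ≢ 2 → ∀ S → AtMostTwoColors (pairing n) S → ∣ S ∣ ≤ ⌈ n /2⌉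
  two-colored⇒∣S∣≤⌈n/2⌉ n≢2 S two
    with any? (λ i → any? (λ j → (i ∈? S) ×-dec (j ∈? S) ×-dec ¬? (i ≟ j) ×-dec (pair i ≟ pair j)))
  ... | yes (i , j , i∈S , j∈S , i≢j , pi≡pj) =
    ≤-trans (red-edge⇒∣S∣≤2 two i∈S j∈S i≢j pi≡pj) (2≤⌈n/2⌉ n≢2 i≢j)
  ... | no ¬red = injectiveOn⇒∣S∣≤m S pair pair-injective
    where
    pair-injective : ∀ {i j} → i ∈ S → j ∈ S → pair i ≡ pair j → i ≡ j
    pair-injective {i} {j} i∈S j∈S pi≡pj with i ≟ j
    ... | yes i≡j = i≡j
    ... | no i≢j  = contradiction (i , j , i∈S , j∈S , i≢j , pi≡pj) ¬red

-- A blue set with one vertex from every pair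

first-side : ∀ n → Subset n
first-side zero          = []
first-side (suc zero)    = inside ∷ []
first-side (suc (suc n)) = inside ∷ outside ∷ first-side n

∣first-side∣ : ∀ n → ∣ first-side n ∣ ≡ ⌈ n /2⌉
∣first-side∣ zero          = refl
∣first-side∣ (suc zero)    = refl
∣first-side∣ (suc (suc n)) = cong suc (∣first-side∣ n)

∈first-side⇒side≡0 : ∀ {n} {i : Fin n} → i ∈ first-side n → side i ≡ zero
∈first-side⇒side≡0 {suc zero}    here               = refl
∈first-side⇒side≡0 {suc (suc n)} here               = refl
∈first-side⇒side≡0 {suc (suc n)} (there (there i∈)) = ∈first-side⇒side≡0 i∈

-- Distinct vertices on one side belong to different pairs, so every edge is blue and this color
-- fills both slots.
first-side-two-colored : ∀ n → AtMostTwoColors (pairing n) (first-side n)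
first-side-two-colored n = blue , blue , λ i j i∈ j∈ i≢j →
  let si≡sj = trans (∈first-side⇒side≡0 i∈) (sym (∈first-side⇒side≡0 j∈))
  in inj₁ (pairing-blue⁺ (λ pi≡pj → i≢j (pair-side-injective pi≡pj si≡sj)) si≡sj)

h₂-pairing : ∀ {n} → n ≢ 2 → h₂ pairing n ≔ ⌈ n /2⌉
h₂-pairing {n} n≢2 =
  (first-side n , ∣first-side∣ n , first-side-two-colored n) ,
  λ { l (S , refl , two) → two-colored⇒∣S∣≤⌈n/2⌉ n≢2 S two }

lemma3p2 : (n : ℕ) → n ≢ 2 → h₂[ n , rrb ∷ bbr ∷ yyr ∷ [] ]≔ ⌈ n /2⌉
lemma3p2 n n≢2 =
  (pairing n , pairing-forb , h₂-pairing n≢2) ,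
  λ { k (c , forb , _ , k-max) → ⌈n/2⌉≤k c forb k-max }
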